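{- Let $G$ be a $3$-connected split graph with at least $13$ vertices that is $\{K_{1,4},K_{1,4}+e\}$-free. Then $G$ is Hamilton-connected, i.e., for every pair of distinct vertices $u,v\in V(G)$ there is a path in $G$ with endpoints $u$ and $v$ that contains every vertex of $G$.
   Context: All graphs are finite, simple and connected. A connected graph $G$ is a split graph if its vertex set can be partitioned into a clique and an independent set (either possibly empty). A graph is $\{F_1,\dots,F_k\}$-free if it contains no induced subgraph isomorphic to any $F_i$. $K_{1,4}$ is the star with four leaves, and $K_{1,4}+e$ is the graph obtained from $K_{1,4}$ by adding one edge joining two nonadjacent vertices (i.e., joining two leaves). -}

module Defs where

open import Data.Nat using (ℕ; _<_; _≤_)
open import Data.Fin using (Fin; zero; suc)
open import Data.Bool using (Bool; true; false)
open import Data.List using (List; []; _∷_; length)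
open import Data.List.Membership.Propositional using (_∈_; _∉_)
open import Data.List.Relation.Unary.All using (All)
open import Data.List.Relation.Unary.Unique.Propositional using (Unique)
open import Data.Product using (Σ; _×_; ∃)
open import Function.Definitions using (Injective)
open import Relation.Binary.PropositionalEquality using (_≡_)
open import Relation.Nullary using (¬_)

record Graph (n : ℕ) : Set where
  field
    adj  : Fin n → Fin n → Bool
    sym  : ∀ u v → adj u v ≡ adj v u
    irr  : ∀ u → adj u u ≡ false

open Graph public

Adj : ∀ {n} → Graph n → Fin n → Fin n → Set
Adj G u v = adj G u v ≡ true

data Walk {n : ℕ} (G : Graph n) : Fin n → Fin n → List (Fin n) → Set where
  single : ∀ u → Walk G u u (u ∷ [])
  step   : ∀ {u w v ps} → Adj G u w → Walk G w v ps → Walk G u v (u ∷ ps)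

ConnectedAvoiding : ∀ {n} → Graph n → List (Fin n) → Set
ConnectedAvoiding {n} G S =
  ∀ (u v : Fin n) → u ∉ S → v ∉ S →
    ∃ λ ps → Walk G u v ps × All (λ x → x ∉ S) ps

Connected : ∀ {n} → Graph n → Set
Connected G = ConnectedAvoiding G []

KConnected : ℕ → ∀ {n} → Graph n → Set
KConnected k {n} G =
  k < n × (∀ (S : List (Fin n)) → length S < k → ConnectedAvoiding G S)

IsSplit : ∀ {n} → Graph n → Set
IsSplit {n} G = Σ (Fin n → Bool) λ inK →
  (∀ u v → inK u ≡ true → inK v ≡ true → ¬ (u ≡ v) → Adj G u v) ×
  (∀ u v → inK u ≡ false → inK v ≡ false → adj G u v ≡ false)

InducedSub : ∀ {m n} → Graph m → Graph n → Set
InducedSub {m} {n} H G = Σ (Fin m → Fin n) λ f →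
  Injective _≡_ _≡_ f × (∀ i j → adj G (f i) (f j) ≡ adj H i j)

Free : ∀ {m n} → Graph m → Graph n → Set
Free H G = ¬ InducedSub H G

k14adj : Fin 5 → Fin 5 → Bool
k14adj zero zero = false
k14adj zero (suc _) = true
k14adj (suc _) zero = true
k14adj (suc _) (suc _) = false

K14 : Graph 5
K14 = record { adj = k14adj ; sym = s ; irr = i }
  where
  s : ∀ u v → k14adj u v ≡ k14adj v u
  s zero zero = _≡_.refl
  s zero (suc _) = _≡_.refl
  s (suc _) zero = _≡_.refl
  s (suc _) (suc _) = _≡_.refl
  i : ∀ u → k14adj u u ≡ false
  i zero = _≡_.refl
  i (suc _) = _≡_.refl

k14eadj : Fin 5 → Fin 5 → Bool
k14eadj zero zero = false
k14eadj zero (suc _) = true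
k14eadj (suc _) zero = true
k14eadj (suc zero) (suc (suc zero)) = true
k14eadj (suc (suc zero)) (suc zero) = true
k14eadj (suc _) (suc _) = false

K14e : Graph 5
K14e = record { adj = k14eadj ; sym = s ; irr = i }
  where
  s : ∀ u v → k14eadj u v ≡ k14eadj v u
  s zero zero = _≡_.refl
  s zero (suc _) = _≡_.refl
  s (suc _) zero = _≡_.refl
  s (suc zero) (suc zero) = _≡_.refl
  s (suc zero) (suc (suc zero)) = _≡_.refl
  s (suc zero) (suc (suc (suc _))) = _≡_.refl
  s (suc (suc zero)) (suc zero) = _≡_.refl
  s (suc (suc zero)) (suc (suc zero)) = _≡_.refl
  s (suc (suc zero)) (suc (suc (suc _))) = _≡_.refl
  s (suc (suc (suc _))) (suc zero) = _≡_.refl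
  s (suc (suc (suc _))) (suc (suc zero)) = _≡_.refl
  s (suc (suc (suc _))) (suc (suc (suc _))) = _≡_.refl
  i : ∀ u → k14eadj u u ≡ false
  i zero = _≡_.refl
  i (suc zero) = _≡_.refl
  i (suc (suc zero)) = _≡_.refl
  i (suc (suc (suc _))) = _≡_.refl

HamiltonPath : ∀ {n} → Graph n → Fin n → Fin n → Set
HamiltonPath {n} G u v = ∃ λ ps →
  Walk G u v ps × Unique ps × (∀ (x : Fin n) → x ∈ ps)

HamiltonConnected : ∀ {n} → Graph n → Set
HamiltonConnected {n} G = ∀ (u v : Fin n) → ¬ (u ≡ v) → HamiltonPath G u v

{-# OPTIONS --safe #-}

-- Let the split partition be (K , I) with m = |I|; moving at most one vertex, no vertex of I is adjacent to
-- all of K.  If a, b in I have a common neighbour, then forbidding K14e leaves at most one vertex of K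
-- adjacent to neither.  Hence, by short alternating paths, every i in I can be given two private
-- neighbours in K, all avoiding one prescribed vertex f, as soon as more than 2m vertices of K have a
-- neighbour in I.  When m ≤ 3 this follows from |K| ≥ 10.  When m ≥ 4, either the neighbourhoods of all
-- but one vertex of I are disjoint, giving 3(m - 1) > 2m such vertices, or m = 4 and all |K| ≥ 9 vertices
-- of K have a neighbour in I.  The paths p i q through these private neighbours have their ends in the clique
-- K, so they and the unused clique vertices can be strung together; taking f to be an endpoint in K
-- of the desired Hamilton path keeps that endpoint free.
module Submission where

open import Defs
open import Data.Nat using (ℕ; _≤_)
open import Data.Nat using (zero; suc; _+_; _*_; _<_; s≤s; z≤n; _≤?_)
import Data.Nat.Properties as ℕ
open import Data.Bool using (Bool; true; false; _∨_)
import Data.Bool.Properties as Bool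
open import Data.Fin using (Fin; zero; suc)
import Data.Fin as Fin
open import Data.Fin.Properties using (_≟_; any?; all?; <-cmp)
open import Data.List using (List; []; _∷_; _++_; length; map; filter; allFin; lookup; concatMap)
open import Data.List.Properties using (length-++; length-map; length-tabulate)
open import Data.List.Membership.Propositional using (_∈_; _∉_; find)
open import Data.List.Membership.Propositional.Properties
  using (∈-filter⁺; ∈-filter⁻; ∈-allFin; ∈-lookup; ∈-∃++; ∈-++⁺ˡ; ∈-++⁺ʳ; ∈-++⁻; ∈-map⁺; ∈-map⁻; ∈-concatMap⁻)
open import Data.List.Relation.Unary.Any using (here; there)
open import Data.List.Relation.Unary.All using (All; []; _∷_)
import Data.List.Relation.Unary.All as All
import Data.List.Relation.Unary.All.Properties as All
open import Data.List.Relation.Unary.AllPairs using ([]; _∷_)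
open import Data.List.Relation.Unary.Unique.Propositional using (Unique)
import Data.List.Relation.Unary.Unique.Propositional.Properties as Unique
open import Data.List.Relation.Unary.Unique.DecPropositional using (unique?)
open import Data.List.Relation.Binary.Permutation.Propositional using (_↭_; ↭-refl; ↭-sym; ↭-trans; ↭⇒↭ₛ; prep; swap)
open import Data.List.Relation.Binary.Permutation.Propositional.Properties
  using (∈-resp-↭; All-resp-↭; ↭-length; shift; shifts; drop-∷; ∷↭∷ʳ; ++-comm; ¬x∷xs↭[]; map⁺; ++⁺ˡ)
open import Data.List.Relation.Binary.Permutation.Setoid.Properties using (Unique-resp-↭)
open import Data.Product using (∃; ∃₂; _×_; _,_; proj₁; proj₂)
open import Data.Sum using (_⊎_; inj₁; inj₂; [_,_]′)
import Data.Sum as Sum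
open import Data.Empty using (⊥; ⊥-elim)
open import Function using (_∘_; id)
open import Relation.Binary.Definitions using (tri<; tri≈; tri>)
open import Relation.Binary.PropositionalEquality using (_≡_; _≢_; refl; trans; cong; subst; setoid) renaming (sym to ≡-sym)
open import Relation.Nullary using (¬_; Dec; yes; no; contradiction)
open import Relation.Nullary.Decidable using (_×-dec_; _→-dec_; ¬?; ⌊_⌋)
open import Relation.Unary using (Decidable)

-- Lists without repetition

module _ {A : Set} where

  ∉⇒unique-∷ : ∀ {x : A} {xs} → x ∉ xs → Unique xs → Unique (x ∷ xs)
  ∉⇒unique-∷ x∉ u = All.¬Any⇒All¬ _ x∉ ∷ u

  unique-head : ∀ {x : A} {xs} → Unique (x ∷ xs) → x ∉ xs
  unique-head = Unique.Unique[x∷xs]⇒x∉xs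

  unique-tail : ∀ {x : A} {xs} → Unique (x ∷ xs) → Unique xs
  unique-tail (_ ∷ u) = u

  unique-↭ : ∀ {xs ys : List A} → xs ↭ ys → Unique xs → Unique ys
  unique-↭ p = Unique-resp-↭ (setoid A) (↭⇒↭ₛ p)

  unique-++ʳ : ∀ (xs : List A) {ys} → Unique (xs ++ ys) → Unique ys
  unique-++ʳ []       u = u
  unique-++ʳ (x ∷ xs) u = unique-++ʳ xs (unique-tail u)

  unique-++-disjoint : ∀ {x y : A} {xs ys} → Unique (xs ++ ys) → x ∈ xs → y ∈ ys → x ≢ y
  unique-++-disjoint {xs = _ ∷ xs} u (here refl) y∈ refl = unique-head u (∈-++⁺ʳ xs y∈)
  unique-++-disjoint {xs = _ ∷ xs} u (there x∈)  y∈      = unique-++-disjoint (unique-tail u) x∈ y∈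

  lookup-injective : ∀ {xs : List A} → Unique xs → ∀ {i j} → lookup xs i ≡ lookup xs j → i ≡ j
  lookup-injective {x ∷ xs} u {zero}  {zero}  _  = refl
  lookup-injective {x ∷ xs} u {zero}  {suc j} eq = contradiction (subst (_∈ xs) (≡-sym eq) (∈-lookup j)) (unique-head u)
  lookup-injective {x ∷ xs} u {suc i} {zero}  eq = contradiction (subst (_∈ xs) eq (∈-lookup i)) (unique-head u)
  lookup-injective {x ∷ xs} u {suc i} {suc j} eq = cong suc (lookup-injective (unique-tail u) eq)

  extract : ∀ {x : A} {xs} → x ∈ xs → ∃ λ ys → xs ↭ x ∷ ys
  extract x∈ with ys , zs , refl ← ∈-∃++ x∈ = ys ++ zs , shift _ ys zs

  length-⊆ : ∀ {xs ys : List A} → Unique xs → (∀ {x} → x ∈ xs → x ∈ ys) → length xs ≤ length ys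
  length-⊆ {[]}     u xs⊆ys = z≤n
  length-⊆ {x ∷ xs} u xs⊆ys with zs , p ← extract (xs⊆ys (here refl)) =
    subst (suc (length xs) ≤_) (≡-sym (↭-length p)) (s≤s (length-⊆ (unique-tail u) xs⊆zs))
    where
    xs⊆zs : ∀ {y} → y ∈ xs → y ∈ zs
    xs⊆zs y∈ with ∈-resp-↭ p (xs⊆ys (there y∈))
    ... | here refl = contradiction y∈ (unique-head u)
    ... | there q   = q

  length-filter-complement : ∀ {P Q : A → Set} (P? : Decidable P) (Q? : Decidable Q) →
    (∀ x → P x ⊎ Q x) → ∀ xs → length xs ≤ length (filter P? xs) + length (filter Q? xs)
  length-filter-complement P? Q? P∪Q [] = z≤n
  length-filter-complement P? Q? P∪Q (x ∷ xs) with ih ← length-filter-complement P? Q? P∪Q xs | P? x | Q? x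
  ... | yes p | yes q = s≤s (ℕ.≤-trans ih (ℕ.+-monoʳ-≤ (length (filter P? xs)) (ℕ.n≤1+n _)))
  ... | yes p | no ¬q = s≤s ih
  ... | no ¬p | yes q = ℕ.≤-trans (s≤s ih) (ℕ.≤-reflexive (≡-sym (ℕ.+-suc _ _)))
  ... | no ¬p | no ¬q = ⊥-elim ([ ¬p , ¬q ]′ (P∪Q x))

  length-concatMap : ∀ {B : Set} (f : A → List B) {k} xs → (∀ {x} → x ∈ xs → k ≤ length (f x)) →
    length xs * k ≤ length (concatMap f xs)
  length-concatMap f []       _ = z≤n
  length-concatMap f (x ∷ xs) h rewrite length-++ (f x) {concatMap f xs} =
    ℕ.+-mono-≤ (h (here refl)) (length-concatMap f xs (h ∘ there))

  concatMap-unique : ∀ {B : Set} (f : A → List B) {xs} → Unique xs → (∀ {x} → x ∈ xs → Unique (f x)) →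
    (∀ {x y b} → x ∈ xs → y ∈ xs → x ≢ y → b ∈ f x → b ∈ f y → ⊥) → Unique (concatMap f xs)
  concatMap-unique f {[]}     _ _  _    = []
  concatMap-unique f {x ∷ xs} u uf disj =
    Unique.++⁺ (uf (here refl))
      (concatMap-unique f (unique-tail u) (uf ∘ there) (λ p q → disj (there p) (there q)))
      λ (b∈fx , b∈rest) → let y , y∈ , b∈fy = find (∈-concatMap⁻ f b∈rest) in
        disj (here refl) (there y∈) (λ x≡y → unique-head u (subst (_∈ xs) (≡-sym x≡y) y∈)) b∈fx b∈fy

module _ {n : ℕ} where

  open import Data.List.Membership.DecPropositional (_≟_ {n}) using (_∈?_)

  -- Pigeonhole; the counting arguments below draw their fresh vertices from it.
  pick-outside : ∀ {xs ys : List (Fin n)} → Unique xs → length ys < length xs → ∃ λ x → x ∈ xs × x ∉ ys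
  pick-outside {xs} {ys} u lt with any? (λ x → (x ∈? xs) ×-dec ¬? (x ∈? ys))
  ... | yes found = found
  ... | no none = contradiction (length-⊆ u xs⊆ys) (ℕ.<⇒≱ lt)
    where
    xs⊆ys : ∀ {x} → x ∈ xs → x ∈ ys
    xs⊆ys {x} x∈ with x ∈? ys
    ... | yes y = y
    ... | no x∉ = contradiction (x , x∈ , x∉) none

-- Walks and induced subgraphs

walk-++ : ∀ {n} {G : Graph n} {u a w v ps qs} →
  Walk G u a ps → Adj G a w → Walk G w v qs → Walk G u v (ps ++ qs)
walk-++ (single _) aw W = step aw W
walk-++ (step e V) aw W = step e (walk-++ V aw W)

-- Both adjacencies are symmetric and irreflexive, so the pairs above the diagonal decide all
-- others.
upper-triangle⇒induced : ∀ {m n} (H : Graph m) (G : Graph n) (f : Fin m → Fin n) →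
  (∀ {i j} → f i ≡ f j → i ≡ j) →
  (∀ i j → i Fin.< j → adj G (f i) (f j) ≡ adj H i j) → InducedSub H G
upper-triangle⇒induced H G f inj up = f , inj , agree
  where
  agree : ∀ i j → adj G (f i) (f j) ≡ adj H i j
  agree i j with <-cmp i j
  ... | tri< i<j _ _ = up i j i<j
  ... | tri≈ _ refl _ = trans (irr G (f i)) (≡-sym (irr H i))
  ... | tri> _ _ j<i = trans (Graph.sym G (f i) (f j)) (trans (up j i j<i) (Graph.sym H j i))

head∈walk : ∀ {n} {G : Graph n} {u v ps} → Walk G u v ps → u ∈ ps
head∈walk (single _) = here refl
head∈walk (step _ _) = here refl

last∈walk : ∀ {n} {G : Graph n} {u v ps} → Walk G u v ps → v ∈ ps
last∈walk (single _) = here refl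
last∈walk (step _ W) = there (last∈walk W)

-- Neighbourhoods, induced stars and minimum degree

module Adjacency {n} (G : Graph n) where

  Nonadj : Fin n → Fin n → Set
  Nonadj u v = adj G u v ≡ false

  adj-sym : ∀ {u v} → Adj G u v → Adj G v u
  adj-sym {u} {v} = trans (Graph.sym G v u)

  adj-or-nonadj : ∀ u v → Adj G u v ⊎ Nonadj u v
  adj-or-nonadj u v with adj G u v
  ... | true  = inj₁ refl
  ... | false = inj₂ refl

  adj-nonadj-⊥ : ∀ {u v} → Adj G u v → Nonadj u v → ⊥
  adj-nonadj-⊥ e ¬e with () ← trans (≡-sym e) ¬e

  ¬adj⇒nonadj : ∀ {u v} → ¬ Adj G u v → Nonadj u v
  ¬adj⇒nonadj {u} {v} ¬e with adj-or-nonadj u v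
  ... | inj₁ e = contradiction e ¬e
  ... | inj₂ ne = ne

  ¬nonadj⇒adj : ∀ {u v} → ¬ Nonadj u v → Adj G u v
  ¬nonadj⇒adj {u} {v} ¬ne with adj-or-nonadj u v
  ... | inj₁ e = e
  ... | inj₂ ne = contradiction ne ¬ne

  distinguished : ∀ {u v w} → Adj G u w → Nonadj v w → u ≢ v
  distinguished e ne refl = adj-nonadj-⊥ e ne

  adj? : ∀ u v → Dec (Adj G u v)
  adj? u v = adj G u v Bool.≟ true

  neighbours : Fin n → List (Fin n)
  neighbours v = filter (λ u → adj? u v) (allFin n)

  neighbours-unique : ∀ v → Unique (neighbours v)
  neighbours-unique v = Unique.filter⁺ (λ u → adj? u v) (Unique.allFin⁺ n)

  ∈-neighbours⁻ : ∀ {u v} → u ∈ neighbours v → Adj G u v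
  ∈-neighbours⁻ {u} {v} = proj₂ ∘ ∈-filter⁻ (λ u → adj? u v) {xs = allFin n}

  ∈-neighbours⁺ : ∀ {u v} → Adj G u v → u ∈ neighbours v
  ∈-neighbours⁺ {u} {v} = ∈-filter⁺ (λ u → adj? u v) (∈-allFin u)

  private
    center-unique : ∀ {x ls} → All (Adj G x) ls → Unique ls → Unique (x ∷ ls)
    center-unique {x} es = ∉⇒unique-∷ λ x∈ → adj-nonadj-⊥ (All.lookup es x∈) (irr G x)

  induced-K14 : ∀ {x a b c d} → All (Adj G x) (a ∷ b ∷ c ∷ d ∷ []) → Unique (a ∷ b ∷ c ∷ d ∷ []) →
    Nonadj a b → Nonadj a c → Nonadj a d → Nonadj b c → Nonadj b d → Nonadj c d → InducedSub K14 G
  induced-K14 {x} {a} {b} {c} {d} es@(xa ∷ xb ∷ xc ∷ xd ∷ []) u ab ac ad bc bd cd =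
    upper-triangle⇒induced K14 G (lookup vs) (lookup-injective (center-unique es u)) up
    where
    vs = x ∷ a ∷ b ∷ c ∷ d ∷ []
    up : ∀ i j → i Fin.< j → adj G (lookup vs i) (lookup vs j) ≡ k14adj i j
    up zero (suc zero) _ = xa
    up zero (suc (suc zero)) _ = xb
    up zero (suc (suc (suc zero))) _ = xc
    up zero (suc (suc (suc (suc zero)))) _ = xd
    up (suc zero) (suc (suc zero)) _ = ab
    up (suc zero) (suc (suc (suc zero))) _ = ac
    up (suc zero) (suc (suc (suc (suc zero)))) _ = ad
    up (suc (suc zero)) (suc (suc (suc zero))) _ = bc
    up (suc (suc zero)) (suc (suc (suc (suc zero)))) _ = bd
    up (suc (suc (suc zero))) (suc (suc (suc (suc zero)))) _ = cd
    up zero zero ()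
    up (suc _) zero ()
    up (suc (suc _)) (suc zero) (s≤s ())
    up (suc (suc (suc _))) (suc (suc zero)) (s≤s (s≤s ()))
    up (suc (suc (suc (suc _)))) (suc (suc (suc zero))) (s≤s (s≤s (s≤s ())))
    up (suc zero) (suc zero) (s≤s ())
    up (suc (suc zero)) (suc (suc zero)) (s≤s (s≤s ()))
    up (suc (suc (suc zero))) (suc (suc (suc zero))) (s≤s (s≤s (s≤s ())))
    up (suc (suc (suc (suc zero)))) (suc (suc (suc (suc zero)))) (s≤s (s≤s (s≤s (s≤s ()))))

  induced-K14e : ∀ {x p q r s} → All (Adj G x) (p ∷ q ∷ r ∷ s ∷ []) → Adj G p q → r ≢ s →
    Nonadj p r → Nonadj p s → Nonadj q r → Nonadj q s → Nonadj r s → InducedSub K14e G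
  induced-K14e {x} {p} {q} {r} {s} es@(xp ∷ xq ∷ xr ∷ xs ∷ []) pq r≢s pr ps qr qs rs =
    upper-triangle⇒induced K14e G (lookup vs) (lookup-injective (center-unique es u)) up
    where
    vs = x ∷ p ∷ q ∷ r ∷ s ∷ []
    flip : ∀ {u v} → Nonadj u v → Nonadj v u
    flip {u} {v} = trans (Graph.sym G v u)
    u : Unique (p ∷ q ∷ r ∷ s ∷ [])
    -- Any two leaves other than `r` and `s` are told apart by a vertex adjacent to exactly one of
    -- them.
    u = (distinguished pq (irr G q) ∷ distinguished pq (flip qr) ∷ distinguished pq (flip qs) ∷ [])
      ∷ (distinguished (adj-sym pq) (flip pr) ∷ distinguished (adj-sym pq) (flip ps) ∷ [])
      ∷ (r≢s ∷ []) ∷ [] ∷ []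
    up : ∀ i j → i Fin.< j → adj G (lookup vs i) (lookup vs j) ≡ k14eadj i j
    up zero (suc zero) _ = xp
    up zero (suc (suc zero)) _ = xq
    up zero (suc (suc (suc zero))) _ = xr
    up zero (suc (suc (suc (suc zero)))) _ = xs
    up (suc zero) (suc (suc zero)) _ = pq
    up (suc zero) (suc (suc (suc zero))) _ = pr
    up (suc zero) (suc (suc (suc (suc zero)))) _ = ps
    up (suc (suc zero)) (suc (suc (suc zero))) _ = qr
    up (suc (suc zero)) (suc (suc (suc (suc zero)))) _ = qs
    up (suc (suc (suc zero))) (suc (suc (suc (suc zero)))) _ = rs
    up zero zero ()
    up (suc _) zero ()
    up (suc (suc _)) (suc zero) (s≤s ())
    up (suc (suc (suc _))) (suc (suc zero)) (s≤s (s≤s ()))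
    up (suc (suc (suc (suc _)))) (suc (suc (suc zero))) (s≤s (s≤s (s≤s ())))
    up (suc zero) (suc zero) (s≤s ())
    up (suc (suc zero)) (suc (suc zero)) (s≤s (s≤s ()))
    up (suc (suc (suc zero))) (suc (suc (suc zero))) (s≤s (s≤s (s≤s ())))
    up (suc (suc (suc (suc zero)))) (suc (suc (suc (suc zero)))) (s≤s (s≤s (s≤s (s≤s ()))))

  -- Deleting fewer than `k` neighbours of `v` would cut `v` off from some remaining vertex `w`,
  -- which exists because `k < n`: a walk that avoids them cannot take its first step.
  kconnected⇒degree : ∀ {k} → KConnected k G → ∀ v → k ≤ length (neighbours v)
  kconnected⇒degree {k} (k<n , conn) v with k ≤? length (neighbours v)
  ... | yes k≤ = k≤
  ... | no k≰
    with few ← ℕ.≰⇒> k≰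
    with w , _ , w∉ ← pick-outside {ys = v ∷ neighbours v} (Unique.allFin⁺ n)
      (subst (suc (length (neighbours v)) <_) (≡-sym (length-tabulate id)) (ℕ.≤-<-trans few k<n))
    with conn (neighbours v) few v w (λ v∈ → adj-nonadj-⊥ (∈-neighbours⁻ v∈) (irr G v)) (w∉ ∘ there)
  ... | _ , single _ , _ = contradiction (here refl) w∉
  ... | _ , step e (single _) , _ ∷ x∉ ∷ _ = contradiction (∈-neighbours⁺ (adj-sym e)) x∉
  ... | _ , step e (step _ _) , _ ∷ x∉ ∷ _ = contradiction (∈-neighbours⁺ (adj-sym e)) x∉

-- Split partitions, and segments through the independent set

module SplitPartition {n} (G : Graph n) (inK : Fin n → Bool)
  (clique : ∀ u v → inK u ≡ true → inK v ≡ true → ¬ (u ≡ v) → Adj G u v)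
  (independent : ∀ u v → inK u ≡ false → inK v ≡ false → adj G u v ≡ false)
  where

  open Adjacency G
  open import Data.List.Membership.DecPropositional (_≟_ {n}) using (_∈?_)

  IsK IsI : Fin n → Set
  IsK u = inK u ≡ true
  IsI u = inK u ≡ false

  K-or-I : ∀ u → IsK u ⊎ IsI u
  K-or-I u with inK u
  ... | true  = inj₁ refl
  ... | false = inj₂ refl

  K-I-⊥ : ∀ {u} → IsK u → IsI u → ⊥
  K-I-⊥ k i with () ← trans (≡-sym k) i

  adj-I⇒K : ∀ {u i} → IsI i → Adj G u i → IsK u
  adj-I⇒K {u} {i} i∈I ui with K-or-I u
  ... | inj₁ k = k
  ... | inj₂ u∈I = ⊥-elim (adj-nonadj-⊥ ui (independent u i u∈I i∈I))

  isK? : ∀ u → Dec (IsK u)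
  isK? u = inK u Bool.≟ true

  isI? : ∀ u → Dec (IsI u)
  isI? u = inK u Bool.≟ false

  Ks Is : List (Fin n)
  Ks = filter isK? (allFin n)
  Is = filter isI? (allFin n)

  ∈-Is⁺ : ∀ {i} → IsI i → i ∈ Is
  ∈-Is⁺ = ∈-filter⁺ isI? (∈-allFin _)

  ∈-Is⁻ : ∀ {i} → i ∈ Is → IsI i
  ∈-Is⁻ = proj₂ ∘ ∈-filter⁻ isI? {xs = allFin n}

  ∈-Ks⁻ : ∀ {k} → k ∈ Ks → IsK k
  ∈-Ks⁻ = proj₂ ∘ ∈-filter⁻ isK? {xs = allFin n}

  Is-unique : Unique Is
  Is-unique = Unique.filter⁺ isI? (Unique.allFin⁺ n)

  Ks-unique : Unique Ks
  Ks-unique = Unique.filter⁺ isK? (Unique.allFin⁺ n)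

  n≤∣K∣+∣I∣ : n ≤ length Ks + length Is
  n≤∣K∣+∣I∣ = subst (_≤ length Ks + length Is) (length-tabulate id)
    (length-filter-complement isK? isI? K-or-I (allFin n))

  -- A segment (p , i , q) stands for the path p i q, whose ends lie in the clique.
  Segment : Fin n × Fin n × Fin n → Set
  Segment (p , i , q) = IsI i × Adj G p i × Adj G q i

  flatten : List (Fin n × Fin n × Fin n) → List (Fin n)
  flatten [] = []
  flatten ((p , i , q) ∷ Ts) = p ∷ i ∷ q ∷ flatten Ts

  extract-segment : ∀ {x Ts} → All Segment Ts → x ∈ flatten Ts → ∃₂ λ p i → ∃₂ λ q Ts′ →
    Segment (p , i , q) × All Segment Ts′ × flatten Ts ↭ p ∷ i ∷ q ∷ flatten Ts′ × x ∈ p ∷ i ∷ q ∷ []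
  extract-segment (s ∷ ss) (here refl) = _ , _ , _ , _ , s , ss , ↭-refl , here refl
  extract-segment (s ∷ ss) (there (here refl)) = _ , _ , _ , _ , s , ss , ↭-refl , there (here refl)
  extract-segment (s ∷ ss) (there (there (here refl))) = _ , _ , _ , _ , s , ss , ↭-refl , there (there (here refl))
  extract-segment {Ts = (p₀ , i₀ , q₀) ∷ Ts} (s ∷ ss) (there (there (there x∈)))
    with p , i , q , Ts′ , s′ , ss′ , ρ , x∈piq ← extract-segment ss x∈ =
      p , i , q , (p₀ , i₀ , q₀) ∷ Ts′ , s′ , s ∷ ss′ ,
      ↭-trans (prep p₀ (prep i₀ (prep q₀ ρ))) (shifts (p₀ ∷ i₀ ∷ q₀ ∷ []) (p ∷ i ∷ q ∷ [])) , x∈piq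

  -- A segment can be read in either direction, so a clique vertex on it may be taken as its first
  -- vertex.
  extract-K : ∀ {x Ts} → All Segment Ts → IsK x → x ∈ flatten Ts → ∃₂ λ i q → ∃ λ Ts′ →
    Segment (x , i , q) × All Segment Ts′ × flatten Ts ↭ x ∷ i ∷ q ∷ flatten Ts′
  extract-K ss x∈K x∈ with extract-segment ss x∈
  ... | p , i , q , Ts′ , s , ss′ , ρ , here refl = i , q , Ts′ , s , ss′ , ρ
  ... | p , i , q , Ts′ , (i∈ , _) , ss′ , ρ , there (here refl) = ⊥-elim (K-I-⊥ x∈K i∈)
  ... | p , i , q , Ts′ , (i∈ , pi , qi) , ss′ , ρ , there (there (here refl)) =
    i , p , Ts′ , (i∈ , qi , pi) , ss′ , ↭-trans ρ (↭-trans (shifts (p ∷ i ∷ []) (q ∷ [])) (prep q (swap p i ↭-refl)))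

  extract-I : ∀ {x Ts} → All Segment Ts → IsI x → x ∈ flatten Ts → ∃₂ λ p q → ∃ λ Ts′ →
    Segment (p , x , q) × All Segment Ts′ × flatten Ts ↭ p ∷ x ∷ q ∷ flatten Ts′
  extract-I ss x∈I x∈ with extract-segment ss x∈
  ... | p , i , q , Ts′ , (i∈ , pi , qi) , ss′ , ρ , here refl = ⊥-elim (K-I-⊥ (adj-I⇒K i∈ pi) x∈I)
  ... | p , i , q , Ts′ , s , ss′ , ρ , there (here refl) = p , q , Ts′ , s , ss′ , ρ
  ... | p , i , q , Ts′ , (i∈ , pi , qi) , ss′ , ρ , there (there (here refl)) = ⊥-elim (K-I-⊥ (adj-I⇒K i∈ qi) x∈I)

  -- Stringing segments together into Hamilton paths

  join : ∀ {u a e v A E} → Walk G u a A → IsK a → Walk G e v E → IsK e → Unique (A ++ E) → Walk G u v (A ++ E)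
  -- The two ends that meet are distinct because the concatenation has no repetition; being in the
  -- clique, they are adjacent.
  join V a∈ W e∈ u = walk-++ V (clique _ _ a∈ e∈ (unique-++-disjoint u (last∈walk V) (head∈walk W))) W

  prepend-Ks : ∀ {e v E} R → All IsK R → Walk G e v E → IsK e → Unique (R ++ E) →
    ∃ λ e′ → IsK e′ × Walk G e′ v (R ++ E)
  prepend-Ks [] _ W e∈ _ = _ , e∈ , W
  prepend-Ks (r ∷ R) (r∈ ∷ R∈) W e∈ u with _ , e′∈ , W′ ← prepend-Ks R R∈ W e∈ (unique-tail u) =
    r , r∈ , join (single r) r∈ W′ e′∈ u

  prepend-segments : ∀ {e v E Ts} → All Segment Ts → Walk G e v E → IsK e → Unique (flatten Ts ++ E) →
    ∃ λ e′ → IsK e′ × Walk G e′ v (flatten Ts ++ E)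
  prepend-segments [] W e∈ _ = _ , e∈ , W
  prepend-segments ((i∈ , pi , qi) ∷ ss) W e∈ u
    with _ , e′∈ , W′ ← prepend-segments ss W e∈ (unique-tail (unique-tail (unique-tail u))) =
      _ , adj-I⇒K i∈ pi , join (step pi (step (adj-sym qi) (single _))) (adj-I⇒K i∈ qi) W′ e′∈ u

  -- The clique vertices outside the pieces (among them those of Q) are inserted before the last piece.
  assemble : ∀ {u a e v A E Ts F} Q → Walk G u a A → IsK a → All Segment Ts → Walk G e v E → IsK e →
    All IsK Q → Unique F → (∀ {i} → IsI i → i ∈ F) → F ↭ Q ++ A ++ flatten Ts ++ E → HamiltonPath G u v
  assemble {A = A} {E} {Ts} {F} Q V a∈ ss W e∈ Q∈ uF I⊆F ρ =
    P , join V a∈ (proj₂ (proj₂ W″)) (proj₁ (proj₂ W″)) uP , uP , spanning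
    where
    B R P : List (Fin n)
    B = A ++ flatten Ts ++ E
    R = filter (λ k → ¬? (k ∈? B)) (allFin n)
    P = A ++ flatten Ts ++ R ++ E
    R⁻ : ∀ {k} → k ∈ R → k ∉ B
    R⁻ k∈ = proj₂ (∈-filter⁻ (λ k → ¬? (k ∈? B)) {xs = allFin n} k∈)
    I⊆B : ∀ {i} → IsI i → i ∈ B
    I⊆B i∈ with ∈-++⁻ Q (∈-resp-↭ ρ (I⊆F i∈))
    ... | inj₁ i∈Q = ⊥-elim (K-I-⊥ (All.lookup Q∈ i∈Q) i∈)
    ... | inj₂ i∈B = i∈B
    -- All of I lies in `B`, so whatever is left over belongs to the clique.
    R∈ : All IsK R
    R∈ = All.tabulate λ {k} k∈ → [ id , (λ k∈I → contradiction (I⊆B k∈I) (R⁻ k∈)) ]′ (K-or-I k)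
    σ : R ++ B ↭ P
    σ = ↭-trans (shifts R A) (++⁺ˡ A (shifts R (flatten Ts)))
    uP : Unique P
    uP = unique-↭ σ (Unique.++⁺ (Unique.filter⁺ (λ k → ¬? (k ∈? B)) (Unique.allFin⁺ n))
      (unique-++ʳ Q (unique-↭ ρ uF)) λ (k∈R , k∈B) → R⁻ k∈R k∈B)
    uTRE : Unique (flatten Ts ++ R ++ E)
    uTRE = unique-++ʳ A uP
    W′ = prepend-Ks R R∈ W e∈ (unique-++ʳ (flatten Ts) uTRE)
    W″ = prepend-segments ss (proj₂ (proj₂ W′)) (proj₁ (proj₂ W′)) uTRE
    spanning : ∀ x → x ∈ P
    spanning x with x ∈? B
    ... | yes x∈B = ∈-resp-↭ σ (∈-++⁺ʳ R x∈B)
    ... | no x∉B = ∈-resp-↭ σ (∈-++⁺ˡ (∈-filter⁺ (λ k → ¬? (k ∈? B)) (∈-allFin x) x∉B))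

  -- The last piece is `v` alone. The first piece is `u` alone if `u` is a clique vertex off the
  -- segments, the whole segment of `u` if `u` is an end of it, and `u p` if `u` is the middle of
  -- `p u q`; in the last case `q` is released and inserted later.
  hamilton-path-to-K : ∀ {u v Ts} → u ≢ v → IsK v → All Segment Ts → Unique (flatten Ts) →
    (∀ {i} → IsI i → i ∈ flatten Ts) → v ∉ flatten Ts → HamiltonPath G u v
  hamilton-path-to-K {u} {v} {Ts} u≢v v∈K ss uniq I⊆ v∉ with K-or-I u | u ∈? flatten Ts
  ... | inj₁ u∈K | no u∉ =
    assemble [] (single u) u∈K ss (single v) v∈K []
      (∉⇒unique-∷ (λ { (here v≡u) → u≢v (≡-sym v≡u) ; (there p) → v∉ p }) (∉⇒unique-∷ u∉ uniq))
      (there ∘ there ∘ I⊆) (∷↭∷ʳ v (u ∷ flatten Ts))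
  ... | inj₁ u∈K | yes u∈ with i , q , Ts′ , (i∈ , ui , qi) , ss′ , ρ ← extract-K ss u∈K u∈ =
    assemble [] (step ui (step (adj-sym qi) (single q))) (adj-I⇒K i∈ qi) ss′ (single v) v∈K []
      (∉⇒unique-∷ v∉ uniq) (there ∘ I⊆) (↭-trans (prep v ρ) (∷↭∷ʳ v (u ∷ i ∷ q ∷ flatten Ts′)))
  ... | inj₂ u∈I | _ with p , q , Ts′ , (_ , pu , qu) , ss′ , ρ ← extract-I ss u∈I (I⊆ u∈I) =
    assemble (q ∷ []) (step (adj-sym pu) (single p)) (adj-I⇒K u∈I pu) ss′ (single v) v∈K (adj-I⇒K u∈I qu ∷ [])
      (∉⇒unique-∷ v∉ uniq) (there ∘ I⊆)
      (↭-trans (prep v ρ) (↭-trans (∷↭∷ʳ v (p ∷ u ∷ q ∷ flatten Ts′))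
        (↭-trans (swap p u ↭-refl) (shift q (u ∷ p ∷ []) (flatten Ts′ ++ v ∷ [])))))

  -- The segment `p v q` is cut so that the path ends with `p v`, and `q` is released. If `u` is in
  -- I as well, its own segment is different and is cut in the same way to start the path.
  hamilton-path-to-I : ∀ {u v Ts} → u ≢ v → IsI v → All Segment Ts → Unique (flatten Ts) →
    (∀ {i} → IsI i → i ∈ flatten Ts) → (IsK u → u ∉ flatten Ts) → HamiltonPath G u v
  hamilton-path-to-I {u} {v} {Ts} u≢v v∈I ss uniq I⊆ u∉ with K-or-I u
  ... | inj₁ u∈K with p , q , Ts′ , (_ , pv , qv) , ss′ , ρ ← extract-I ss v∈I (I⊆ v∈I) =
    assemble (q ∷ []) (single u) u∈K ss′ (step pv (single v)) (adj-I⇒K v∈I pv) (adj-I⇒K v∈I qv ∷ [])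
      (∉⇒unique-∷ (u∉ u∈K) uniq) (there ∘ I⊆)
      (↭-trans (prep u ρ) (↭-trans (shift q (u ∷ p ∷ v ∷ []) (flatten Ts′))
        (prep q (prep u (++-comm (p ∷ v ∷ []) (flatten Ts′))))))
  ... | inj₂ u∈I
    with p , q , Ts′ , (_ , pu , qu) , ss′ , ρ ← extract-I ss u∈I (I⊆ u∈I)
    with ∈-resp-↭ ρ (I⊆ v∈I)
  ... | here refl = ⊥-elim (K-I-⊥ (adj-I⇒K u∈I pu) v∈I)
  ... | there (here refl) = contradiction refl u≢v
  ... | there (there (here refl)) = ⊥-elim (K-I-⊥ (adj-I⇒K u∈I qu) v∈I)
  ... | there (there (there v∈))
    with p′ , q′ , Ts″ , (_ , pv , qv) , ss″ , ρ′ ← extract-I ss′ v∈I v∈ =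
    assemble (q ∷ q′ ∷ []) (step (adj-sym pu) (single p)) (adj-I⇒K u∈I pu) ss″ (step pv (single v)) (adj-I⇒K v∈I pv)
      (adj-I⇒K u∈I qu ∷ adj-I⇒K v∈I qv ∷ []) uniq I⊆
      (↭-trans ρ (↭-trans (swap p u (prep q ρ′)) (↭-trans (shift q (u ∷ p ∷ []) (p′ ∷ v ∷ q′ ∷ flatten Ts″))
        (prep q (↭-trans (shift q′ (u ∷ p ∷ p′ ∷ v ∷ []) (flatten Ts″))
          (prep q′ (prep u (prep p (++-comm (p′ ∷ v ∷ []) (flatten Ts″))))))))))

  -- Pairs in I with a common neighbour, and the forbidden subgraphs

  Misses : Fin n → Fin n → Fin n → Set
  Misses a b y = Nonadj y a × Nonadj y b

  Covered : Fin n → Set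
  Covered y = ∃ λ i → IsI i × Adj G y i

  record Sharing (a b : Fin n) : Set where
    constructor sharing
    field
      a∈I  : IsI a
      b∈I  : IsI b
      a≢b  : a ≢ b
      hub  : Fin n
      hub₁ : Adj G hub a
      hub₂ : Adj G hub b

  sharing-sym : ∀ {a b} → Sharing a b → Sharing b a
  sharing-sym (sharing a b a≢b x xa xb) = sharing b a (a≢b ∘ ≡-sym) x xb xa

  module Forbidden (K14-free : Free K14 G) (K14e-free : Free K14e G) where

    no-four-I-neighbours : ∀ {x a b c d} → All IsI (a ∷ b ∷ c ∷ d ∷ []) → Unique (a ∷ b ∷ c ∷ d ∷ []) →
      All (Adj G x) (a ∷ b ∷ c ∷ d ∷ []) → ⊥
    no-four-I-neighbours (a ∷ b ∷ c ∷ d ∷ []) u es = K14-free (induced-K14 es u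
      (independent _ _ a b) (independent _ _ a c) (independent _ _ a d)
      (independent _ _ b c) (independent _ _ b d) (independent _ _ c d))

    -- A clique vertex misses at most one of three vertices of I with a common neighbour `x`. If `y`
    -- missed `a` and `b`, the star at `x` with leaves `y`, `a`, `b`, `c` would be induced, up to a
    -- possible edge `y c`: either K14 or K14e.
    missing-one-of-three : ∀ {x a b c y} → All IsI (a ∷ b ∷ c ∷ []) → Unique (a ∷ b ∷ c ∷ []) →
      All (Adj G x) (a ∷ b ∷ c ∷ []) → IsK y → Nonadj y a → Adj G y b
    missing-one-of-three {x} {a} {b} {c} {y} (a∈ ∷ b∈ ∷ c∈ ∷ [])
      ((a≢b ∷ a≢c ∷ []) ∷ (b≢c ∷ []) ∷ [] ∷ []) (xa ∷ xb ∷ xc ∷ []) y∈ ya = ¬nonadj⇒adj λ yb → bad yb (adj-or-nonadj y c)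
      where
      xy : Adj G x y
      xy = clique x y (adj-I⇒K a∈ xa) y∈ (distinguished xa ya)
      K≢I : ∀ {i} → IsI i → y ≢ i
      K≢I i∈ refl = K-I-⊥ y∈ i∈
      bad : Nonadj y b → Adj G y c ⊎ Nonadj y c → ⊥
      bad yb (inj₁ yc) = K14e-free (induced-K14e (xy ∷ xc ∷ xa ∷ xb ∷ []) yc a≢b ya yb
        (independent _ _ c∈ a∈) (independent _ _ c∈ b∈) (independent _ _ a∈ b∈))
      bad yb (inj₂ yc) = K14-free (induced-K14 (xy ∷ xa ∷ xb ∷ xc ∷ [])
        ((K≢I a∈ ∷ K≢I b∈ ∷ K≢I c∈ ∷ []) ∷ (a≢b ∷ a≢c ∷ []) ∷ (b≢c ∷ []) ∷ [] ∷ [])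
        ya yb yc (independent _ _ a∈ b∈) (independent _ _ a∈ c∈) (independent _ _ b∈ c∈))

    -- Otherwise the hub, with leaves `y`, `z`, `a`, `b` and the clique edge `y z`, induces K14e.
    missed-at-most-once : ∀ {a b y z} → Sharing a b → IsK y → IsK z → y ≢ z →
      Misses a b y → Misses a b z → ⊥
    missed-at-most-once {y = y} {z} (sharing a∈ b∈ a≢b x xa xb) y∈ z∈ y≢z (ya , yb) (za , zb) =
      K14e-free (induced-K14e (x-to y∈ ya ∷ x-to z∈ za ∷ xa ∷ xb ∷ []) (clique y z y∈ z∈ y≢z) a≢b
        ya yb za zb (independent _ _ a∈ b∈))
      where
      x-to : ∀ {w} → IsK w → Nonadj w _ → Adj G x w
      x-to w∈ wa = clique x _ (adj-I⇒K a∈ xa) w∈ (distinguished xa wa)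

    hits-one : ∀ {a b y z} → Sharing a b → IsK y → IsK z → y ≢ z →
      (Adj G y a ⊎ Adj G y b) ⊎ (Adj G z a ⊎ Adj G z b)
    hits-one {a} {b} {y} {z} s y∈ z∈ y≢z
      with adj-or-nonadj y a | adj-or-nonadj y b | adj-or-nonadj z a | adj-or-nonadj z b
    ... | inj₁ ya | _ | _ | _ = inj₁ (inj₁ ya)
    ... | inj₂ _ | inj₁ yb | _ | _ = inj₁ (inj₂ yb)
    ... | inj₂ _ | inj₂ _ | inj₁ za | _ = inj₂ (inj₁ za)
    ... | inj₂ _ | inj₂ _ | inj₂ _ | inj₁ zb = inj₂ (inj₂ zb)
    ... | inj₂ ya | inj₂ yb | inj₂ za | inj₂ zb = ⊥-elim (missed-at-most-once s y∈ z∈ y≢z (ya , yb) (za , zb))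

    -- Structure of the common neighbours when I has at least four vertices

    module Coverage (13≤n : 13 ≤ n)
      (degree≥3 : ∀ i → 3 ≤ length (neighbours i))
      (maximal : ∀ {a} → IsI a → ∃ λ w → IsK w × Nonadj w a)
      where

      three-neighbours : ∀ i → ∃ λ y₁ → ∃ λ y₂ → ∃ λ y₃ →
        Unique (y₁ ∷ y₂ ∷ y₃ ∷ []) × All (λ y → Adj G y i) (y₁ ∷ y₂ ∷ y₃ ∷ [])
      three-neighbours i with neighbours i | degree≥3 i | neighbours-unique i | (λ {y} → ∈-neighbours⁻ {y} {i})
      ... | y₁ ∷ y₂ ∷ y₃ ∷ _ | _ | (y₁₂ ∷ y₁₃ ∷ _) ∷ (y₂₃ ∷ _) ∷ _ | adjacent =
        y₁ , y₂ , y₃ , ((y₁₂ ∷ y₁₃ ∷ []) ∷ (y₂₃ ∷ []) ∷ [] ∷ []) ,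
        adjacent (here refl) ∷ adjacent (there (here refl)) ∷ adjacent (there (there (here refl))) ∷ []
      ... | _ ∷ _ ∷ [] | s≤s (s≤s ()) | _ | _
      ... | _ ∷ [] | s≤s () | _ | _
      ... | [] | () | _ | _

      -- Two of the three neighbours of d would miss the same sharing pair.
      not-all-miss : ∀ {d a b a′ b′} → IsI d → Sharing a b → Sharing a′ b′ →
        (∀ {y} → Adj G y d → Misses a b y ⊎ Misses a′ b′ y) → ⊥
      not-all-miss {d} d∈ s s′ miss
        with y₁ , y₂ , y₃ , ((y₁₂ ∷ y₁₃ ∷ []) ∷ (y₂₃ ∷ []) ∷ _) , (e₁ ∷ e₂ ∷ e₃ ∷ []) ← three-neighbours d
        with k₁ ← adj-I⇒K d∈ e₁ | k₂ ← adj-I⇒K d∈ e₂ | k₃ ← adj-I⇒K d∈ e₃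
        with miss e₁ | miss e₂ | miss e₃
      ... | inj₁ p | inj₁ q | _      = missed-at-most-once s k₁ k₂ y₁₂ p q
      ... | inj₁ p | inj₂ _ | inj₁ r = missed-at-most-once s k₁ k₃ y₁₃ p r
      ... | inj₁ _ | inj₂ q | inj₂ r = missed-at-most-once s′ k₂ k₃ y₂₃ q r
      ... | inj₂ _ | inj₁ q | inj₁ r = missed-at-most-once s k₂ k₃ y₂₃ q r
      ... | inj₂ p | inj₁ _ | inj₂ r = missed-at-most-once s′ k₁ k₃ y₁₃ p r
      ... | inj₂ p | inj₂ q | _      = missed-at-most-once s′ k₁ k₂ y₁₂ p q

      pick-I : ∀ ls → length ls < length Is → ∃ λ i → IsI i × i ∉ ls
      pick-I ls lt with i , i∈ , i∉ ← pick-outside Is-unique lt = i , ∈-Is⁻ i∈ , i∉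

      -- With four vertices in I the clique has at least nine, more than twice four, so covering all
      -- of it is enough for the matchings.
      AllCovered : Set
      AllCovered = length Is ≡ 4 × (∀ y → IsK y → Covered y)

      -- In the graph on I whose edges are the sharing pairs, every edge contains `a`; the
      -- neighbourhoods of the other vertices of I are thus pairwise disjoint.
      Star : Fin n → Set
      Star a = ∀ p q → Sharing p q → p ≢ a → q ≢ a → ⊥

      exactly-four : 4 ≤ length Is → ¬ (5 ≤ length Is) → length Is ≡ 4
      exactly-four 4≤m 5≰m = ℕ.≤-antisym (ℕ.≤-pred (ℕ.≰⇒> 5≰m)) 4≤m

      -- Every vertex of the clique would be adjacent to a.
      no-five : ∀ {x y a b c d e} → All IsI (a ∷ b ∷ c ∷ d ∷ e ∷ []) → Unique (a ∷ b ∷ c ∷ d ∷ e ∷ []) →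
        All (Adj G x) (a ∷ b ∷ c ∷ []) → All (Adj G y) (a ∷ b ∷ d ∷ []) → ⊥
      no-five {x} {y} {a} {b} {c} {d} {e} (a∈ ∷ b∈ ∷ c∈ ∷ d∈ ∷ e∈ ∷ [])
        ((ab ∷ ac ∷ ad ∷ ae ∷ []) ∷ (bc ∷ bd ∷ be ∷ []) ∷ (cd ∷ ce ∷ []) ∷ (de ∷ []) ∷ [] ∷ [])
        (xa ∷ xb ∷ xc ∷ []) (ya ∷ yb ∷ yd ∷ [])
        with z , _ , _ , _ , ze ∷ _ ← three-neighbours e
        with w , w∈ , wa ← maximal a∈ =
          at-most-three w∈ wa (missing-one-of-three (a∈ ∷ e∈ ∷ b∈ ∷ [])
            ((ae ∷ ab ∷ []) ∷ ((be ∘ ≡-sym) ∷ []) ∷ [] ∷ []) (za ∷ ze ∷ zb ∷ []) w∈ wa)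
        where
        ba : b ≢ a
        ba = ab ∘ ≡-sym
        -- A clique vertex missing `a` sees `b` and `c` because of `x`, and `d` because of `y`, so a
        -- neighbour `e` would be its fourth in I.
        at-most-three : ∀ {w} → IsK w → Nonadj w a → Adj G w e → ⊥
        at-most-three w∈ wa we = no-four-I-neighbours (b∈ ∷ c∈ ∷ d∈ ∷ e∈ ∷ [])
          ((bc ∷ bd ∷ be ∷ []) ∷ (cd ∷ ce ∷ []) ∷ (de ∷ []) ∷ [] ∷ [])
          ( missing-one-of-three (a∈ ∷ b∈ ∷ c∈ ∷ []) ((ab ∷ ac ∷ []) ∷ (bc ∷ []) ∷ [] ∷ []) (xa ∷ xb ∷ xc ∷ []) w∈ wa
          ∷ missing-one-of-three (a∈ ∷ c∈ ∷ b∈ ∷ []) ((ac ∷ ab ∷ []) ∷ ((bc ∘ ≡-sym) ∷ []) ∷ [] ∷ []) (xa ∷ xc ∷ xb ∷ []) w∈ wa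
          ∷ missing-one-of-three (a∈ ∷ d∈ ∷ b∈ ∷ []) ((ad ∷ ab ∷ []) ∷ ((bd ∘ ≡-sym) ∷ []) ∷ [] ∷ []) (ya ∷ yd ∷ yb ∷ []) w∈ wa
          ∷ we ∷ [])
        z∈ : IsK z
        z∈ = adj-I⇒K e∈ ze
        za : Adj G z a
        za = ¬nonadj⇒adj λ na → at-most-three z∈ na ze
        -- If `z` missed `b`, it would see `c` because of `x` and `d` because of `y`, besides `a`
        -- and `e`. So `z` is a common neighbour of `a`, `b`, `e`, and this triple forces `w` to see
        -- `e`.
        zb : Adj G z b
        zb = ¬nonadj⇒adj λ nb → no-four-I-neighbours (a∈ ∷ c∈ ∷ d∈ ∷ e∈ ∷ [])
          ((ac ∷ ad ∷ ae ∷ []) ∷ (cd ∷ ce ∷ []) ∷ (de ∷ []) ∷ [] ∷ [])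
          ( za
          ∷ missing-one-of-three (b∈ ∷ c∈ ∷ a∈ ∷ []) ((bc ∷ ba ∷ []) ∷ ((ac ∘ ≡-sym) ∷ []) ∷ [] ∷ []) (xb ∷ xc ∷ xa ∷ []) z∈ nb
          ∷ missing-one-of-three (b∈ ∷ d∈ ∷ a∈ ∷ []) ((bd ∷ ba ∷ []) ∷ ((ad ∘ ≡-sym) ∷ []) ∷ [] ∷ []) (yb ∷ yd ∷ ya ∷ []) z∈ nb
          ∷ ze ∷ [])

      -- A clique vertex misses at most one of `a`, `b`, `c`, hence is covered. With five vertices
      -- in I, a neighbour `y` of a fourth vertex `d` would share with `x` two of `a`, `b`, `c`,
      -- which `no-five` excludes.
      triple⇒allCovered : ∀ {x a b c} → All IsI (a ∷ b ∷ c ∷ []) → Unique (a ∷ b ∷ c ∷ []) →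
        All (Adj G x) (a ∷ b ∷ c ∷ []) → 4 ≤ length Is → AllCovered
      triple⇒allCovered {x} {a} {b} {c} abc∈@(a∈ ∷ b∈ ∷ c∈ ∷ []) u xs@(xa ∷ xb ∷ xc ∷ []) 4≤m =
        exactly-four 4≤m not-five , covered
        where
        covered : ∀ y → IsK y → Covered y
        covered y y∈ with adj-or-nonadj y a
        ... | inj₁ ya = a , a∈ , ya
        ... | inj₂ ya = b , b∈ , missing-one-of-three abc∈ u xs y∈ ya
        not-five : ¬ (5 ≤ length Is)
        not-five 5≤m
          with d , d∈ , d∉ ← pick-I (a ∷ b ∷ c ∷ []) 4≤m
          with e , e∈ , e∉ ← pick-I (d ∷ a ∷ b ∷ c ∷ []) 5≤m
          with y , _ , _ , _ , yd ∷ _ ← three-neighbours d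
          = choose (adj-or-nonadj y a) (adj-or-nonadj y b)
          where
          u₅ : Unique (e ∷ d ∷ a ∷ b ∷ c ∷ [])
          u₅ = ∉⇒unique-∷ e∉ (∉⇒unique-∷ d∉ u)
          y∈ : IsK y
          y∈ = adj-I⇒K d∈ yd
          -- The triple is reordered so that `p` and `q`, seen by both `x` and `y`, come first; then
          -- `r` is seen by `x`, `d` by `y`, and `e` is the fifth vertex.
          contra : ∀ {p q r} → (a ∷ b ∷ c ∷ []) ↭ (p ∷ q ∷ r ∷ []) → Adj G y p → Adj G y q → ⊥
          contra {p} {q} {r} ρ yp yq =
            no-five {x} {y} (All-resp-↭ σ (e∈ ∷ d∈ ∷ abc∈)) (unique-↭ σ u₅) (All-resp-↭ ρ xs) (yp ∷ yq ∷ yd ∷ [])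
            where
            σ : (e ∷ d ∷ a ∷ b ∷ c ∷ []) ↭ (p ∷ q ∷ r ∷ d ∷ e ∷ [])
            σ = ↭-trans (swap e d ρ) (shifts (d ∷ e ∷ []) (p ∷ q ∷ r ∷ []))
          missing : ∀ {p q r} → (a ∷ b ∷ c ∷ []) ↭ (p ∷ q ∷ r ∷ []) → Nonadj y p → Adj G y q
          missing ρ = missing-one-of-three (All-resp-↭ ρ abc∈) (unique-↭ ρ u) (All-resp-↭ ρ xs) y∈
          acb : (a ∷ b ∷ c ∷ []) ↭ (a ∷ c ∷ b ∷ [])
          acb = prep a (swap b c ↭-refl)
          bca : (a ∷ b ∷ c ∷ []) ↭ (b ∷ c ∷ a ∷ [])
          bca = ↭-trans (swap a b ↭-refl) (prep b (swap a c ↭-refl))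
          choose : Adj G y a ⊎ Nonadj y a → Adj G y b ⊎ Nonadj y b → ⊥
          choose (inj₁ ya) (inj₁ yb) = contra ↭-refl ya yb
          choose (inj₁ ya) (inj₂ nb) = contra acb ya (missing bca nb)
          choose (inj₂ na) _ = contra bca (missing ↭-refl na) (missing acb na)

      -- The case where no three vertices of I have a common neighbour

      module _ (no-triple : ∀ {x a b c} → All IsI (a ∷ b ∷ c ∷ []) → Unique (a ∷ b ∷ c ∷ []) →
                            All (Adj G x) (a ∷ b ∷ c ∷ []) → ⊥) where

        third-nonadj : ∀ {x a b c} → IsI a → IsI b → IsI c → a ≢ b → a ≢ c → b ≢ c →
          Adj G x a → Adj G x b → Nonadj x c
        third-nonadj a∈ b∈ c∈ ab ac bc xa xb = ¬adj⇒nonadj λ xc →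
          no-triple (a∈ ∷ b∈ ∷ c∈ ∷ []) ((ab ∷ ac ∷ []) ∷ (bc ∷ []) ∷ [] ∷ []) (xa ∷ xb ∷ xc ∷ [])

        common-neighbour? : ∀ p q → Dec (∃ λ y → Adj G y p × Adj G y q)
        common-neighbour? p q = any? λ y → adj? y p ×-dec adj? y q

        -- If `d` shared no neighbour with `a`, each neighbour of `d` would miss `a` and, having at
        -- most one further neighbour in I, also `b` or `c`. All of them would then miss one of two
        -- sharing pairs.
        all-share : ∀ {a b c} → Sharing a b → Sharing a c → b ≢ c → ∀ {d} → IsI d → d ≢ a → Sharing d a
        all-share {a} {b} {c} sab@(sharing a∈ b∈ _ _ _ _) sac@(sharing _ c∈ _ _ _ _) b≢c {d} d∈ d≢a
          with d ≟ b | d ≟ c | common-neighbour? d a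
        ... | yes refl | _ | _ = sharing-sym sab
        ... | no _ | yes refl | _ = sharing-sym sac
        ... | no _ | no _ | yes (y , yd , ya) = sharing d∈ a∈ d≢a y yd ya
        ... | no d≢b | no d≢c | no none = ⊥-elim (not-all-miss d∈ sab sac miss)
          where
          miss : ∀ {y} → Adj G y d → Misses a b y ⊎ Misses a c y
          miss {y} yd with na ← ¬adj⇒nonadj (λ ya → none (y , yd , ya)) | adj-or-nonadj y b
          ... | inj₁ yb = inj₂ (na , third-nonadj d∈ b∈ c∈ d≢b d≢c b≢c yd yb)
          ... | inj₂ nb = inj₁ (na , nb)

        -- If a sharing pair `p`, `q` avoids `a`, a further vertex `r` shares with `a`, and the two
        -- disjoint sharing pairs force the second alternative.
        star-or-allCovered : ∀ {a b c} → Sharing a b → Sharing a c → b ≢ c → 4 ≤ length Is → Star a ⊎ AllCovered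
        star-or-allCovered {a} sab@(sharing a∈ _ _ _ _ _) sac b≢c 4≤m
          with any? (λ p → any? (λ q → isI? p ×-dec isI? q ×-dec ¬? (p ≟ q)
            ×-dec ¬? (p ≟ a) ×-dec ¬? (q ≟ a) ×-dec common-neighbour? p q))
        ... | no none = inj₁ λ { p q (sharing p∈ q∈ p≢q w wp wq) p≢a q≢a →
          none (p , q , p∈ , q∈ , p≢q , p≢a , q≢a , w , wp , wq) }
        ... | yes (p , q , p∈ , q∈ , p≢q , p≢a , q≢a , w , wp , wq)
          with r , r∈ , r∉ ← pick-I (a ∷ p ∷ q ∷ []) 4≤m
          with sra@(sharing _ _ r≢a t tr ta) ← all-share sab sac b≢c r∈ (r∉ ∘ here)
          = inj₂ (exactly-four 4≤m not-five , covered)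
          where
          spq : Sharing p q
          spq = sharing p∈ q∈ p≢q w wp wq
          r≢p : r ≢ p
          r≢p = r∉ ∘ there ∘ here
          r≢q : r ≢ q
          r≢q = r∉ ∘ there ∘ there ∘ here
          covered : ∀ y → IsK y → Covered y
          covered y y∈ with any? (λ k → isI? k ×-dec adj? y k)
          ... | yes found = found
          -- An uncovered `y` misses `p` and `q`, and so does the hub `t` of `r` and `a`, which has
          -- no third neighbour in I.
          ... | no none = ⊥-elim (missed-at-most-once spq (adj-I⇒K r∈ tr) y∈ (distinguished tr (missed r∈))
            ( third-nonadj r∈ a∈ p∈ r≢a r≢p (p≢a ∘ ≡-sym) tr ta
            , third-nonadj r∈ a∈ q∈ r≢a r≢q (q≢a ∘ ≡-sym) tr ta) (missed p∈ , missed q∈))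
            where
            missed : ∀ {k} → IsI k → Nonadj y k
            missed {k} k∈ = ¬adj⇒nonadj λ yk → none (k , k∈ , yk)
          not-five : ¬ (5 ≤ length Is)
          -- Each neighbour of a fifth vertex `s` sees at most one other vertex of I, so it misses
          -- both `p` and `q` or both `r` and `a`.
          not-five 5≤m with s , s∈ , s∉ ← pick-I (r ∷ a ∷ p ∷ q ∷ []) 5≤m = not-all-miss s∈ spq sra miss
            where
            s≢r : s ≢ r
            s≢r = s∉ ∘ here
            s≢a : s ≢ a
            s≢a = s∉ ∘ there ∘ here
            via : ∀ {y k} → IsI k → s ≢ k → k ≢ r → k ≢ a → Adj G y s → Adj G y k → Misses r a y
            via k∈ s≢k k≢r k≢a ys yk = third-nonadj s∈ k∈ r∈ s≢k s≢r k≢r ys yk , third-nonadj s∈ k∈ a∈ s≢k s≢a k≢a ys yk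
            miss : ∀ {y} → Adj G y s → Misses p q y ⊎ Misses r a y
            miss {y} ys with adj-or-nonadj y p | adj-or-nonadj y q
            ... | inj₁ yp | _ = inj₂ (via p∈ (s∉ ∘ there ∘ there ∘ here) (r≢p ∘ ≡-sym) p≢a ys yp)
            ... | inj₂ _ | inj₁ yq = inj₂ (via q∈ (s∉ ∘ there ∘ there ∘ there ∘ here) (r≢q ∘ ≡-sym) q≢a ys yq)
            ... | inj₂ np | inj₂ nq = inj₁ (np , nq)

        -- A third vertex `c` shares with `a` or with `b`, since otherwise all its neighbours would
        -- miss the pair. So `a` or `b` has two sharing partners.
        no-triple⇒star-or-allCovered : ∀ {a b} → Sharing a b → 4 ≤ length Is → ∃ Star ⊎ AllCovered
        no-triple⇒star-or-allCovered {a} {b} sab@(sharing a∈ b∈ _ _ _ _) 4≤m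
          with c , c∈ , c∉ ← pick-I (a ∷ b ∷ []) (ℕ.≤-trans (ℕ.n≤1+n 3) 4≤m)
          with common-neighbour? c a | common-neighbour? c b
        ... | yes (y , yc , ya) | _ = Sum.map₁ (a ,_)
          (star-or-allCovered sab (sharing a∈ c∈ (c∉ ∘ here ∘ ≡-sym) y ya yc) (c∉ ∘ there ∘ here ∘ ≡-sym) 4≤m)
        ... | no _ | yes (y , yc , yb) = Sum.map₁ (b ,_)
          (star-or-allCovered (sharing-sym sab) (sharing b∈ c∈ (c∉ ∘ there ∘ here ∘ ≡-sym) y yb yc) (c∉ ∘ here ∘ ≡-sym) 4≤m)
        ... | no ¬ca | no ¬cb = ⊥-elim (not-all-miss c∈ sab sab λ yc → inj₁
          ( ¬adj⇒nonadj (λ ya → ¬ca (_ , yc , ya)) , ¬adj⇒nonadj (λ yb → ¬cb (_ , yc , yb))))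

      -- More than 2m covered vertices

      sharing⇒star-or-allCovered : ∀ {a b} → Sharing a b → 4 ≤ length Is → ∃ Star ⊎ AllCovered
      sharing⇒star-or-allCovered s 4≤m
        with any? (λ x → any? (λ a → any? (λ b → any? (λ c →
          All.all? isI? (a ∷ b ∷ c ∷ []) ×-dec unique? _≟_ (a ∷ b ∷ c ∷ []) ×-dec All.all? (adj? x) (a ∷ b ∷ c ∷ [])))))
      ... | yes (_ , _ , _ , _ , abc∈ , u , es) = inj₂ (triple⇒allCovered abc∈ u es 4≤m)
      ... | no none = no-triple⇒star-or-allCovered (λ abc∈ u es → none (_ , _ , _ , _ , abc∈ , u , es)) s 4≤m

      -- The vertices of I other than `a` have disjoint neighbourhoods of size at least three, and
      -- 3(m - 1) > 2m for m ≥ 4. Avoiding an arbitrary list `L` of length at most 2m expresses that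
      -- more than 2m vertices are covered.
      star⇒many-covered : ∀ {a} → Star a → 4 ≤ length Is → ∀ L → length L ≤ length Is + length Is →
        ∃ λ y → y ∉ L × Covered y
      star⇒many-covered {a} star 4≤m L L≤2m = y , y∉ , b , ∈-Is⁻ (proj₁ (J⁻ b∈)) , ∈-neighbours⁻ y∈b
        where
        J : List (Fin n)
        J = filter (λ i → ¬? (i ≟ a)) Is
        J⁻ : ∀ {i} → i ∈ J → i ∈ Is × i ≢ a
        J⁻ = ∈-filter⁻ (λ i → ¬? (i ≟ a)) {xs = Is}
        Is⊆a∷J : ∀ {i} → i ∈ Is → i ∈ a ∷ J
        Is⊆a∷J {i} i∈ with i ≟ a
        ... | yes i≡a = here i≡a
        ... | no i≢a = there (∈-filter⁺ (λ i → ¬? (i ≟ a)) i∈ i≢a)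
        m≤1+j : length Is ≤ suc (length J)
        m≤1+j = length-⊆ Is-unique Is⊆a∷J
        2m<3j : ∀ {m j} → m ≤ suc j → 4 ≤ m → m + m < j * 3
        2m<3j {m} {j} m≤ 4≤ = begin-strict
          m + m           ≤⟨ ℕ.+-mono-≤ m≤ m≤ ⟩
          suc j + suc j   ≡⟨ cong suc (ℕ.+-suc j j) ⟩
          -- From `4 ≤ m` and `m ≤ suc j` follows `3 ≤ j`.
          2 + (j + j)     <⟨ ℕ.+-monoˡ-≤ (j + j) (ℕ.≤-pred (ℕ.≤-trans 4≤ m≤)) ⟩
          j + (j + j)     ≡⟨ cong (λ k → j + (j + k)) (≡-sym (ℕ.+-identityʳ j)) ⟩
          3 * j           ≡⟨ ℕ.*-comm 3 j ⟩
          j * 3           ∎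
          where open ℕ.≤-Reasoning
        found : ∃ λ y → y ∈ concatMap neighbours J × y ∉ L
        found = pick-outside
          (concatMap-unique neighbours (Unique.filter⁺ (λ i → ¬? (i ≟ a)) Is-unique) (λ {i} _ → neighbours-unique i)
            λ p∈ q∈ p≢q yp yq → star _ _
              (sharing (∈-Is⁻ (proj₁ (J⁻ p∈))) (∈-Is⁻ (proj₁ (J⁻ q∈))) p≢q _ (∈-neighbours⁻ yp) (∈-neighbours⁻ yq))
              (proj₂ (J⁻ p∈)) (proj₂ (J⁻ q∈)))
          (ℕ.≤-<-trans L≤2m (ℕ.<-≤-trans (2m<3j m≤1+j 4≤m) (length-concatMap neighbours J λ {i} _ → degree≥3 i)))
        y = proj₁ found
        y∉ = proj₂ (proj₂ found)
        hit = find (∈-concatMap⁻ neighbours {xs = J} (proj₁ (proj₂ found)))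
        b = proj₁ hit
        b∈ = proj₁ (proj₂ hit)
        y∈b = proj₂ (proj₂ hit)

      clique-size : ∀ {c m} → c + m ≤ 13 → length Is ≡ m → c ≤ length Ks
      clique-size {c} {m} c+m≤13 refl = ℕ.+-cancelʳ-≤ m c (length Ks) (ℕ.≤-trans c+m≤13 (ℕ.≤-trans 13≤n n≤∣K∣+∣I∣))

      small⇒large-clique : length Is ≤ 3 → 2 + (length Is + length Is) ≤ length Ks
      small⇒large-clique m≤3 = clique-size (bound m≤3) refl
        where
        bound : ∀ {m} → m ≤ 3 → 2 + (m + m) + m ≤ 13
        -- For m ≤ 3 the left side is 2 + 3m, at most 11.
        bound m≤3 = ℕ.≤-trans (ℕ.+-mono-≤ (ℕ.+-monoʳ-≤ 2 (ℕ.+-mono-≤ m≤3 m≤3)) m≤3) (ℕ.m≤m+n 11 2)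

      -- For m ≤ 3 the clique has two vertices outside `L`, and one of them sees `a` or `b`. For m ≥
      -- 4 the structural alternatives apply.
      sharing⇒many-covered : ∀ {a b} → Sharing a b → ∀ L → length L ≤ length Is + length Is →
        ∃ λ y → y ∉ L × Covered y
      sharing⇒many-covered {a} {b} s L L≤2m with 4 ≤? length Is
      ... | no 4≰m
        with big ← small⇒large-clique (ℕ.≤-pred (ℕ.≰⇒> 4≰m))
        with y , y∈ , y∉ ← pick-outside {ys = L} Ks-unique (ℕ.≤-trans (s≤s L≤2m) (ℕ.≤-trans (ℕ.n≤1+n _) big))
        with z , z∈ , z∉ ← pick-outside {ys = y ∷ L} Ks-unique (ℕ.≤-trans (s≤s (s≤s L≤2m)) big)
        with hits-one s (∈-Ks⁻ y∈) (∈-Ks⁻ z∈) (z∉ ∘ here ∘ ≡-sym)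
      ... | inj₁ (inj₁ ya) = y , y∉ , a , Sharing.a∈I s , ya
      ... | inj₁ (inj₂ yb) = y , y∉ , b , Sharing.b∈I s , yb
      ... | inj₂ (inj₁ za) = z , z∉ ∘ there , a , Sharing.a∈I s , za
      ... | inj₂ (inj₂ zb) = z , z∉ ∘ there , b , Sharing.b∈I s , zb
      sharing⇒many-covered s L L≤2m | yes 4≤m with sharing⇒star-or-allCovered s 4≤m
      ... | inj₁ (_ , star) = star⇒many-covered star 4≤m L L≤2m
      ... | inj₂ (m≡4 , covered)
        -- Here the clique has at least 13 - 4 = 9 vertices and `L` at most 8.
        with y , y∈ , y∉ ← pick-outside {ys = L} Ks-unique
          (ℕ.≤-trans (s≤s (subst (λ m → length L ≤ m + m) m≡4 L≤2m)) (clique-size ℕ.≤-refl m≡4))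
        = y , y∉ , covered y (∈-Ks⁻ y∈)

      -- Matching I twice into the clique, avoiding a vertex f

      module Matchings (f : Fin n) where

        Edge : Fin n × Fin n → Set
        Edge (i , k) = IsI i × Adj G k i

        -- D lists vertices of I, with repetitions if several partners are wanted.
        record Matching (D : List (Fin n)) : Set where
          constructor matching
          field
            pairs    : List (Fin n × Fin n)
            matched  : map proj₁ pairs ↭ D
            edges    : All Edge pairs
            distinct : Unique (f ∷ map proj₂ pairs)

        open Matching

        used : ∀ {D} → Matching D → List (Fin n)
        used M = f ∷ map proj₂ (pairs M)

        length-used : ∀ {D} (M : Matching D) → length (used M) ≡ suc (length D)
        length-used M = cong suc (trans (length-map proj₂ (pairs M))
          (trans (≡-sym (length-map proj₁ (pairs M))) (↭-length (matched M))))

        extract-second : ∀ {x} (E : List (Fin n × Fin n)) → x ∈ map proj₂ E → ∃₂ λ j E′ → E ↭ (j , x) ∷ E′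
        extract-second E x∈ with (j , _) , jx∈ , refl ← ∈-map⁻ proj₂ x∈ = j , extract jx∈

        extract-first : ∀ {i} (E : List (Fin n × Fin n)) → i ∈ map proj₁ E → ∃₂ λ x E′ → E ↭ (i , x) ∷ E′
        extract-first E i∈ with (_ , x) , ix∈ , refl ← ∈-map⁻ proj₁ i∈ = x , extract ix∈

        -- Alternating paths with at most three new edges suffice: if x is already the partner of j, then i
        -- and j share x, so together they see every vertex of the clique with at most one exception.
        augment : ∀ {D i x} (M : Matching D) → IsI i → Adj G x i → x ≢ f → (i , x) ∉ pairs M →
          (∀ {j} → j ∈ D → Sharing i j → ∃₂ λ y k → y ∉ used M × k ∈ i ∷ D × IsI k × Adj G y k) →
          Matching (i ∷ D)
        augment {D} {i} {x} M i∈ xi x≢f ix∉ fresh with x ∈? map proj₂ (pairs M)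
        ... | no x∉ = matching ((i , x) ∷ pairs M) (prep i (matched M)) ((i∈ , xi) ∷ edges M)
          (unique-↭ (swap x f ↭-refl) (∉⇒unique-∷ (λ { (here eq) → x≢f eq ; (there p) → x∉ p }) (distinct M)))
        ... | yes x∈
          with j , E , ρ ← extract-second (pairs M) x∈
          with (j∈ , xj) ∷ edgesE ← All-resp-↭ ρ (edges M) =
            reroute (fresh (∈-resp-↭ (matched M) (∈-resp-↭ (↭-sym (map⁺ proj₁ ρ)) (here refl))) sij)
          where
          sij : Sharing i j
          -- If `j` were `i`, the pair `(i , x)` would already be in `M`.
          sij = sharing i∈ j∈ (λ { refl → ix∉ (∈-resp-↭ (↭-sym ρ) (here refl)) }) x xi xj
          matchedE : j ∷ map proj₁ E ↭ D
          matchedE = ↭-trans (↭-sym (map⁺ proj₁ ρ)) (matched M)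

          reroute : (∃₂ λ y k → y ∉ used M × k ∈ i ∷ D × IsI k × Adj G y k) → Matching (i ∷ D)
          reroute (y , k , y∉ , k∈D , k∈ , yk) = cases (adj-or-nonadj y i) (adj-or-nonadj y j)
            where
            -- Every rerouting keeps all old partners in use and adds exactly `y`, so distinctness
            -- is inherited.
            rebuild : ∀ E* → map proj₁ E* ↭ i ∷ D → All Edge E* → y ∷ map proj₂ (pairs M) ↭ map proj₂ E* → Matching (i ∷ D)
            rebuild E* m es σ = matching E* m es (unique-↭ (↭-trans (swap y f ↭-refl) (prep f σ)) (∉⇒unique-∷ y∉ (distinct M)))

            three-cycle : k ∈ i ∷ D → Nonadj y i → Nonadj y j → Matching (i ∷ D)
            three-cycle (here refl) yi yj = ⊥-elim (adj-nonadj-⊥ yk yi)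
            three-cycle (there k∈D) yi yj with ∈-resp-↭ (↭-sym matchedE) k∈D
            ... | here refl = ⊥-elim (adj-nonadj-⊥ yk yj)
            -- Giving `y` to `k` releases the old partner `p` of `k`. As `y` misses `i` and `j`, `p`
            -- sees one of them: either `i` takes `p`, or `j` takes `p` and hands `x` to `i`.
            ... | there k∈E
              with p , E′ , ρ′ ← extract-first E k∈E
              with (_ , pk) ∷ edgesE′ ← All-resp-↭ ρ′ edgesE
              with σ ← ↭-trans (map⁺ proj₂ ρ) (prep x (map⁺ proj₂ ρ′)) =
                exchange (hits-one sij (adj-I⇒K k∈ pk) (adj-I⇒K k∈ yk) p≢y)
              where
              p≢y : p ≢ y
              p≢y refl = y∉ (there (∈-resp-↭ (↭-sym σ) (there (here refl))))
              matched′ : i ∷ j ∷ k ∷ map proj₁ E′ ↭ i ∷ D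
              matched′ = prep i (↭-trans (prep j (↭-sym (map⁺ proj₁ ρ′))) matchedE)
              rotate : y ∷ map proj₂ (pairs M) ↭ x ∷ p ∷ y ∷ map proj₂ E′
              rotate = ↭-trans (prep y σ) (↭-sym (shift y (x ∷ p ∷ []) (map proj₂ E′)))
              exchange : (Adj G p i ⊎ Adj G p j) ⊎ (Adj G y i ⊎ Adj G y j) → Matching (i ∷ D)
              exchange (inj₁ (inj₁ pi)) = rebuild ((i , p) ∷ (j , x) ∷ (k , y) ∷ E′) matched′
                ((i∈ , pi) ∷ (j∈ , xj) ∷ (k∈ , yk) ∷ edgesE′) (↭-trans rotate (swap x p ↭-refl))
              exchange (inj₁ (inj₂ pj)) = rebuild ((i , x) ∷ (j , p) ∷ (k , y) ∷ E′) matched′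
                ((i∈ , xi) ∷ (j∈ , pj) ∷ (k∈ , yk) ∷ edgesE′) rotate
              exchange (inj₂ (inj₁ e)) = ⊥-elim (adj-nonadj-⊥ e yi)
              exchange (inj₂ (inj₂ e)) = ⊥-elim (adj-nonadj-⊥ e yj)

            cases : Adj G y i ⊎ Nonadj y i → Adj G y j ⊎ Nonadj y j → Matching (i ∷ D)
            cases (inj₁ yi) _ = rebuild ((i , y) ∷ pairs M) (prep i (matched M)) ((i∈ , yi) ∷ edges M) ↭-refl
            cases (inj₂ _) (inj₁ yj) = rebuild ((i , x) ∷ (j , y) ∷ E) (prep i matchedE)
              ((i∈ , xi) ∷ (j∈ , yj) ∷ edgesE) (↭-trans (prep y (map⁺ proj₂ ρ)) (swap y x ↭-refl))
            cases (inj₂ yi) (inj₂ yj) = three-cycle k∈D yi yj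

        pick-neighbour : ∀ i ls → length ls < 3 → ∃ λ x → Adj G x i × x ∉ ls
        pick-neighbour i ls lt with x , x∈ , x∉ ← pick-outside (neighbours-unique i) (ℕ.<-≤-trans lt (degree≥3 i)) =
          x , ∈-neighbours⁻ x∈ , x∉

        single-matching : ∀ S → Unique S → All IsI S → length S ≤ length Is → Matching S
        single-matching [] _ _ _ = matching [] ↭-refl [] ([] ∷ [])
        single-matching (i ∷ S) u (i∈ ∷ S∈) S≤m
          with M ← single-matching S (unique-tail u) S∈ (ℕ.≤-trans (ℕ.n≤1+n _) S≤m)
          with x , xi , x∉ ← pick-neighbour i (f ∷ []) (s≤s (s≤s z≤n)) =
            augment M i∈ xi (x∉ ∘ here) (λ ix∈ → unique-head u (∈-resp-↭ (matched M) (∈-map⁺ proj₁ ix∈))) fresh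
          where
          L≤m : length (used M) ≤ length Is
          L≤m = subst (_≤ length Is) (≡-sym (length-used M)) S≤m
          fresh : ∀ {j} → j ∈ S → Sharing i j → ∃₂ λ y k → y ∉ used M × k ∈ i ∷ S × IsI k × Adj G y k
          fresh {j} j∈S s@(sharing _ j∈ _ _ _ _)
            with y , y∉ , c , c∈ , yc ← sharing⇒many-covered s (used M) (ℕ.≤-trans L≤m (ℕ.m≤m+n _ _))
            -- Including `y`, at most 1 + m ≤ 2m vertices are excluded.
            with z , z∉ , d , d∈ , zd ← sharing⇒many-covered s (y ∷ used M)
              (ℕ.+-mono-≤ (ℕ.≤-trans (s≤s z≤n) S≤m) L≤m)
            with hits-one s (adj-I⇒K c∈ yc) (adj-I⇒K d∈ zd) (z∉ ∘ here ∘ ≡-sym)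
          ... | inj₁ (inj₁ yi) = y , i , y∉ , here refl , i∈ , yi
          ... | inj₁ (inj₂ yj) = y , j , y∉ , there j∈S , j∈ , yj
          ... | inj₂ (inj₁ zi) = z , i , z∉ ∘ there , here refl , i∈ , zi
          ... | inj₂ (inj₂ zj) = z , j , z∉ ∘ there , there j∈S , j∈ , zj

        double-matching : ∀ S → Unique S → All IsI S → length S ≤ length Is → Matching (S ++ Is)
        double-matching [] _ _ _ = single-matching Is Is-unique (All.tabulate ∈-Is⁻) ℕ.≤-refl
        double-matching (i ∷ S) u (i∈ ∷ S∈) S≤m
          with M ← double-matching S (unique-tail u) S∈ (ℕ.≤-trans (ℕ.n≤1+n _) S≤m)
          with I′ , ι ← extract (∈-Is⁺ i∈)
          with σ ← ↭-trans (matched M) (↭-trans (++⁺ˡ S ι) (shift i S I′))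
          with q , E , ρ ← extract-first (pairs M) (∈-resp-↭ (↭-sym σ) (here refl))
          -- Degree three leaves a neighbour besides `f` and the present partner `q` of `i`, its
          -- only partner so far.
          with x , xi , x∉ ← pick-neighbour i (f ∷ q ∷ []) ℕ.≤-refl =
            augment M i∈ xi (x∉ ∘ here) ix∉ fresh
          where
          ix∉ : (i , x) ∉ pairs M
          ix∉ ix∈ with ∈-resp-↭ ρ ix∈
          ... | here refl = x∉ (there (here refl))
          ... | there ix∈E with ∈-++⁻ S (∈-resp-↭ (drop-∷ (↭-trans (↭-sym (map⁺ proj₁ ρ)) σ)) (∈-map⁺ proj₁ ix∈E))
          ...   | inj₁ i∈S = unique-head u i∈S
          ...   | inj₂ i∈I′ = unique-head (unique-↭ ι Is-unique) i∈I′
          fresh : ∀ {j} → j ∈ S ++ Is → Sharing i j → ∃₂ λ y k → y ∉ used M × k ∈ i ∷ S ++ Is × IsI k × Adj G y k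
          fresh _ s with y , y∉ , k , k∈ , yk ← sharing⇒many-covered s (used M)
              (subst (_≤ length Is + length Is) (≡-sym (trans (length-used M) (cong suc (length-++ S))))
                (ℕ.+-monoˡ-≤ (length Is) S≤m)) =
            y , k , y∉ , there (∈-++⁺ʳ S (∈-Is⁺ k∈)) , k∈ , yk

        -- From matchings to segments and Hamilton-connectedness

        pairs⇒segments : ∀ S E → map proj₁ E ↭ S ++ S → All Edge E →
          ∃ λ Ts → All Segment Ts × flatten Ts ↭ S ++ map proj₂ E
        pairs⇒segments [] [] _ _ = [] , [] , ↭-refl
        pairs⇒segments [] (_ ∷ _) ρ _ = ⊥-elim (¬x∷xs↭[] ρ)
        pairs⇒segments (i ∷ S) E m es
          with m₁ ← ↭-trans m (prep i (shift i S S))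
          with p , E₁ , ρ₁ ← extract-first E (∈-resp-↭ (↭-sym m₁) (here refl))
          with m₂ ← drop-∷ (↭-trans (↭-sym (map⁺ proj₁ ρ₁)) m₁)
          with q , E₂ , ρ₂ ← extract-first E₁ (∈-resp-↭ (↭-sym m₂) (here refl))
          with m₃ ← drop-∷ (↭-trans (↭-sym (map⁺ proj₁ ρ₂)) m₂)
          with (i∈ , pi) ∷ es₁ ← All-resp-↭ ρ₁ es
          with (_ , qi) ∷ es₂ ← All-resp-↭ ρ₂ es₁
          with Ts , segs , τ ← pairs⇒segments S E₂ m₃ es₂ =
            (p , i , q) ∷ Ts , (i∈ , pi , qi) ∷ segs ,
            ↭-trans (prep p (prep i (prep q τ))) (↭-trans (swap p i ↭-refl) (prep i
              (↭-trans (shifts (p ∷ q ∷ []) S) (++⁺ˡ S (↭-sym (↭-trans (map⁺ proj₂ ρ₁) (prep p (map⁺ proj₂ ρ₂))))))))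

        -- The two partners of each vertex of I become the ends of its segment. If `f` is in I it is
        -- itself a middle vertex, so avoidance is claimed only for `f` in the clique.
        spanning-segments : ∃ λ Ts → All Segment Ts × Unique (flatten Ts) ×
          (∀ {i} → IsI i → i ∈ flatten Ts) × (IsK f → f ∉ flatten Ts)
        spanning-segments
          with M ← double-matching Is Is-unique (All.tabulate ∈-Is⁻) ℕ.≤-refl
          with Ts , segs , τ ← pairs⇒segments Is (pairs M) (matched M) (edges M) =
            Ts , segs , unique-↭ (↭-sym τ) (Unique.++⁺ Is-unique (unique-tail (distinct M)) disjoint) ,
            (λ i∈ → ∈-resp-↭ (↭-sym τ) (∈-++⁺ˡ (∈-Is⁺ i∈))) ,
            λ f∈K f∈ → [ (λ f∈Is → K-I-⊥ f∈K (∈-Is⁻ f∈Is)) , unique-head (distinct M) ]′ (∈-++⁻ Is (∈-resp-↭ τ f∈))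
          where
          disjoint : ∀ {v} → v ∈ Is × v ∈ map proj₂ (pairs M) → ⊥
          disjoint (v∈I , v∈) with (i , _) , iv∈ , refl ← ∈-map⁻ proj₂ v∈ with i∈ , vi ← All.lookup (edges M) iv∈ =
            K-I-⊥ (adj-I⇒K i∈ vi) (∈-Is⁻ v∈I)

      hamilton-connected : HamiltonConnected G
      hamilton-connected u v u≢v with K-or-I v
      -- The vertex kept free is `v` if it lies in the clique, and `u` otherwise.
      ... | inj₁ v∈K with Ts , segs , uniq , I⊆ , v∉ ← Matchings.spanning-segments v =
        hamilton-path-to-K u≢v v∈K segs uniq I⊆ (v∉ v∈K)
      ... | inj₂ v∈I with Ts , segs , uniq , I⊆ , u∉ ← Matchings.spanning-segments u =
        hamilton-path-to-I u≢v v∈I segs uniq I⊆ u∉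

-- Passing to a maximal clique

theorem1p8 : ∀ {n : ℕ} (G : Graph n) → 13 ≤ n → IsSplit G → KConnected 3 G →
    Free K14 G → Free K14e G → HamiltonConnected G
theorem1p8 {n} G 13≤n (inK , clique , independent) conn K14-free K14e-free
  with any? (λ a → (inK a Bool.≟ false) ×-dec all? (λ w → (inK w Bool.≟ true) →-dec adj? w a))
  where open Adjacency G
... | no none = SplitPartition.Forbidden.Coverage.hamilton-connected G inK clique independent
    K14-free K14e-free 13≤n (kconnected⇒degree conn) maximal
  where
  open Adjacency G
  maximal : ∀ {a} → inK a ≡ false → ∃ λ w → inK w ≡ true × Nonadj w a
  maximal {a} a∈ with any? (λ w → (inK w Bool.≟ true) ×-dec (adj G w a Bool.≟ false))
  ... | yes found = found
  ... | no all = ⊥-elim (none (a , a∈ , λ w w∈ → ¬nonadj⇒adj λ wa → all (w , w∈ , wa)))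
-- The vertex `a`, adjacent to the whole clique, is moved into it.
... | yes (a , a∈ , complete) = SplitPartition.Forbidden.Coverage.hamilton-connected G inK′ clique′ independent′
    K14-free K14e-free 13≤n (kconnected⇒degree conn) maximal
  where
  open Adjacency G
  inK′ : Fin n → Bool
  inK′ u = inK u ∨ ⌊ u ≟ a ⌋
  old : ∀ u → inK′ u ≡ true → inK u ≡ true ⊎ u ≡ a
  old u u∈ with inK u | u ≟ a
  ... | true | _ = inj₁ refl
  ... | false | yes u≡a = inj₂ u≡a
  I′⁻ : ∀ u → inK′ u ≡ false → inK u ≡ false
  I′⁻ u u∈ with inK u
  ... | false = refl
  a∈K′ : inK′ a ≡ true
  a∈K′ with a ≟ a
  ... | yes _ = Bool.∨-zeroʳ (inK a)
  ... | no a≢a = contradiction refl a≢a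
  clique′ : ∀ u v → inK′ u ≡ true → inK′ v ≡ true → ¬ (u ≡ v) → Adj G u v
  clique′ u v u∈ v∈ u≢v with old u u∈ | old v v∈
  ... | inj₁ u∈K | inj₁ v∈K = clique u v u∈K v∈K u≢v
  ... | inj₁ u∈K | inj₂ refl = complete u u∈K
  ... | inj₂ refl | inj₁ v∈K = adj-sym (complete v v∈K)
  ... | inj₂ refl | inj₂ refl = contradiction refl u≢v
  independent′ : ∀ u v → inK′ u ≡ false → inK′ v ≡ false → adj G u v ≡ false
  independent′ u v u∈ v∈ = independent u v (I′⁻ u u∈) (I′⁻ v v∈)
  maximal : ∀ {b} → inK′ b ≡ false → ∃ λ w → inK′ w ≡ true × Nonadj w b
  -- One move is enough: `a` came from the independent set, so it is nonadjacent to every vertex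
  -- left there.
  maximal {b} b∈ = a , a∈K′ , independent a b a∈ (I′⁻ b b∈)
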